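{- Let $G$ be a graph with $\operatorname{nl}(G)=1$ and $\operatorname{Supp}(G)=[s]$, for some $s\in\mathbb{N}$. Then: (1) $G-v$ is singular if and only if $\operatorname{adj}(G)_{vv}=0$. (2) $\operatorname{adj}(G)_{uv}\ne 0$ if and only if $u,v\in\operatorname{Supp}(G)$. (3) $v\in\operatorname{Supp}(G)$ if and only if $G-v$ is nonsingular. (4) If $(x,0)^t\in\mathcal{N}(G)$, with $x\in\mathbb{R}^s\setminus\{0\}$, then \[x_v^2=\det(G-v)\det(G-u),\] for each $v\in\operatorname{Supp}(G)$ and some fixed $u\in\operatorname{Supp}(G)$.
   Context: Graphs are finite and simple, and $[s]=\{1,\dots,s\}$. $A(G)$ is the adjacency matrix of $G$ (over $\mathbb{R}$); $\mathcal{N}(G)$ is its nullspace, $\operatorname{nl}(G)=\dim\mathcal{N}(G)$, $\operatorname{adj}(G)=\operatorname{adj}(A(G))$ is the adjugate of $A(G)$ and $\det(G)=\det(A(G))$. A graph is singular if its adjacency matrix is singular, and nonsingular otherwise. $G-v$ is the graph obtained from $G$ by deleting the vertex $v$. $\operatorname{Supp}(G)$ is the set of vertices $v$ of $G$ such that $x_v\ne 0$ for some $x\in\mathcal{N}(G)$. The vertices are labeled so that those of $\operatorname{Supp}(G)=[s]$ come first, and vectors indexed by the vertices of $G$ are written $(x,0)^t$ with $x$ the part indexed by $\operatorname{Supp}(G)$ and $0$ the part indexed by the remaining vertices.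
   Formalization: Part (4) is false as written (G = K_1, x = (2): x_v^2 = 4 but det(G-v)det(G-u) = 1); it is proved as (c x_v)^2 = det(G-v)det(G-u) for some nonzero scalar c and some u in Supp(G), the same c and u for all v in Supp(G). -}

module Defs where

open import Algebra.Bundles using (CommutativeRing)
open import Algebra.Structures using (IsCommutativeRing)
open import Data.Bool.Base using (if_then_else_)
open import Data.Fin.Base as Fin using (Fin; toℕ; punchIn)
open import Data.Fin.Properties using (_≟_)
open import Data.Nat.Base as ℕ using (ℕ; zero; suc; pred)
import Data.Nat.Properties as ℕ
open import Data.Product.Base using (∃-syntax; _×_; _,_)
open import Data.Rational.Base as ℚ using (ℚ; 0ℚ; 1ℚ; ½; ∣_∣)
import Data.Rational.Properties as ℚ
open import Data.Rational.Solver using (module +-*-Solver)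
open import Data.Vec.Functional using (Vector)
open import Level using (Level; 0ℓ; _⊔_)
open import Relation.Binary.Core using (Rel)
open import Relation.Binary.Definitions
  using (Decidable; Symmetric; Irreflexive)
open import Relation.Binary.PropositionalEquality
  using (_≡_; refl; sym; trans; cong; subst)
open import Relation.Nullary.Decidable.Core using (does)
open import Relation.Nullary.Negation.Core using (¬_)

-- Real numbers: Cauchy sequences of rationals, with ring operations
-- computed termwise and equality meaning that the difference tends to 0.

Null : (ℕ → ℚ) → Set
Null h = ∀ ε → 0ℚ ℚ.< ε → ∃[ N ] ∀ n → N ℕ.≤ n → ∣ h n ∣ ℚ.< ε

Null₂ : (ℕ → ℕ → ℚ) → Set
Null₂ h = ∀ ε → 0ℚ ℚ.< ε →
  ∃[ N ] ∀ m n → N ℕ.≤ m → N ℕ.≤ n → ∣ h m n ∣ ℚ.< ε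

record ℝ : Set where
  constructor mkℝ
  field
    seq    : ℕ → ℚ
    cauchy : Null₂ (λ m n → seq m ℚ.- seq n)

open ℝ public

infix 4 _≈_ _#_

_≈_ : Rel ℝ 0ℓ
x ≈ y = Null (λ n → seq x n ℚ.- seq y n)

-- Apartness: the constructive form of "x ≠ y" for real numbers.
-- Classically it is equivalent to ¬ (x ≈ y).
_#_ : Rel ℝ 0ℓ
x # y = ∃[ ε ] 0ℚ ℚ.< ε ×
  ∃[ N ] (∀ n → N ℕ.≤ n → ε ℚ.≤ ∣ seq x n ℚ.- seq y n ∣)

null⇒null₂ : ∀ {h} → Null h → Null₂ (λ m _ → h m)
null⇒null₂ p ε ε>0 with p ε ε>0
... | N , q = N , λ m _ N≤m _ → q m N≤m

null₂⇒null : ∀ {h} → Null₂ h → Null (λ n → h n n)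
null₂⇒null p ε ε>0 with p ε ε>0
... | N , q = N , λ n N≤n → q n n N≤n N≤n

null₂-cong : ∀ {h k} → (∀ m n → h m n ≡ k m n) → Null₂ h → Null₂ k
null₂-cong eq p ε ε>0 with p ε ε>0
... | N , q = N , λ m n N≤m N≤n →
  subst (λ r → ∣ r ∣ ℚ.< ε) (eq m n) (q m n N≤m N≤n)

null-cong : ∀ {h k} → (∀ n → h n ≡ k n) → Null h → Null k
null-cong eq p = null₂⇒null (null₂-cong (λ m _ → eq m) (null⇒null₂ p))

null₂-0 : Null₂ (λ _ _ → 0ℚ)
null₂-0 ε ε>0 = 0 , λ _ _ _ _ → ε>0

half>0 : ∀ {ε} → 0ℚ ℚ.< ε → 0ℚ ℚ.< ½ ℚ.* ε
half>0 {ε} ε>0 = subst (ℚ._< ½ ℚ.* ε) (ℚ.*-zeroʳ ½) (ℚ.*-monoʳ-<-pos ½ ε>0)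

half+half : ∀ ε → ½ ℚ.* ε ℚ.+ ½ ℚ.* ε ≡ ε
half+half ε = trans (sym (ℚ.*-distribʳ-+ ε ½ ½)) (ℚ.*-identityˡ ε)

null₂-+ : ∀ {h k} → Null₂ h → Null₂ k → Null₂ (λ m n → h m n ℚ.+ k m n)
null₂-+ {h} {k} p q ε ε>0
  with p (½ ℚ.* ε) (half>0 ε>0) | q (½ ℚ.* ε) (half>0 ε>0)
... | M , p′ | N , q′ = M ℕ.⊔ N , λ m n b c →
  ℚ.≤-<-trans (ℚ.∣p+q∣≤∣p∣+∣q∣ (h m n) (k m n))
    (subst (∣ h m n ∣ ℚ.+ ∣ k m n ∣ ℚ.<_) (half+half ε)
      (ℚ.+-mono-<
        (p′ m n (ℕ.m⊔n≤o⇒m≤o M N b) (ℕ.m⊔n≤o⇒m≤o M N c))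
        (q′ m n (ℕ.m⊔n≤o⇒n≤o M N b) (ℕ.m⊔n≤o⇒n≤o M N c))))

null₂-neg : ∀ {h} → Null₂ h → Null₂ (λ m n → ℚ.- h m n)
null₂-neg {h} p ε ε>0 with p ε ε>0
... | N , q = N , λ m n b c →
  subst (ℚ._< ε) (sym (ℚ.∣-p∣≡∣p∣ (h m n))) (q m n b c)

Bounded : (ℕ → ℚ) → Set
Bounded f = ∃[ B ] ℚ.Positive B × ∃[ N ] (∀ n → N ℕ.≤ n → ∣ f n ∣ ℚ.≤ B)

bounded : ∀ x → Bounded (seq x)
bounded x with cauchy x 1ℚ (ℚ.positive⁻¹ 1ℚ)
... | N , q =
  1ℚ ℚ.+ ∣ seq x N ∣ ,
  ℚ.pos+nonNeg⇒pos 1ℚ ∣ seq x N ∣ {{ℚ.∣-∣-nonNeg (seq x N)}} ,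
  N , λ n N≤n →
    ℚ.≤-trans
      (subst (λ r → ∣ r ∣ ℚ.≤ ∣ seq x n ℚ.- seq x N ∣ ℚ.+ ∣ seq x N ∣)
        (split (seq x n) (seq x N))
        (ℚ.∣p+q∣≤∣p∣+∣q∣ (seq x n ℚ.- seq x N) (seq x N)))
      (ℚ.+-monoˡ-≤ ∣ seq x N ∣ (ℚ.<⇒≤ (q n N N≤n ℕ.≤-refl)))
  where
  open +-*-Solver
  split : ∀ a b → (a ℚ.- b) ℚ.+ b ≡ a
  split = solve 2 (λ a b → (a :- b) :+ b := a) refl

scale : ∀ {ε B} .{{_ : ℚ.Positive B}} → 0ℚ ℚ.< ε →
        ∃[ δ ] 0ℚ ℚ.< δ × B ℚ.* δ ≡ ε
scale {ε} {B} ε>0 =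
  1/B ℚ.* ε ,
  subst (ℚ._< 1/B ℚ.* ε) (ℚ.*-zeroʳ 1/B)
    (ℚ.*-monoʳ-<-pos 1/B {{ℚ.1/pos⇒pos B}} ε>0) ,
  trans (sym (ℚ.*-assoc B 1/B ε))
    (trans (cong (ℚ._* ε) (ℚ.*-inverseʳ B {{ℚ.pos⇒nonZero B}}))
      (ℚ.*-identityˡ ε))
  where
  1/B : ℚ
  1/B = (ℚ.1/ B) {{ℚ.pos⇒nonZero B}}

-- The bounded factor may be evaluated at either index, via i.
null₂-* : ∀ {f h} (i : ℕ → ℕ → ℕ) →
          (∀ {N m n} → N ℕ.≤ m → N ℕ.≤ n → N ℕ.≤ i m n) →
          Bounded f → Null₂ h → Null₂ (λ m n → f (i m n) ℚ.* h m n)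
null₂-* {f} {h} i i≥ (B , B>0 , M , bd) p ε ε>0
  with scale {ε} {B} {{B>0}} ε>0
... | δ , δ>0 , Bδ≡ε with p δ δ>0
... | N , q = M ℕ.⊔ N , λ m n b c →
  ℚ.≤-<-trans
    (subst (ℚ._≤ B ℚ.* ∣ h m n ∣) (sym (ℚ.∣p*q∣≡∣p∣*∣q∣ (f (i m n)) (h m n)))
      (ℚ.*-monoʳ-≤-nonNeg ∣ h m n ∣ {{ℚ.∣-∣-nonNeg (h m n)}}
        (bd (i m n)
          (i≥ (ℕ.m⊔n≤o⇒m≤o M N b) (ℕ.m⊔n≤o⇒m≤o M N c)))))
    (subst (B ℚ.* ∣ h m n ∣ ℚ.<_) Bδ≡ε
      (ℚ.*-monoʳ-<-pos B {{B>0}}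
        (q m n (ℕ.m⊔n≤o⇒n≤o M N b) (ℕ.m⊔n≤o⇒n≤o M N c))))

module Identities where
  open +-*-Solver

  sub-self : ∀ a → 0ℚ ≡ a ℚ.- a
  sub-self a = sym (ℚ.+-inverseʳ a)

  sub-swap : ∀ a b → ℚ.- (a ℚ.- b) ≡ b ℚ.- a
  sub-swap = solve 2 (λ a b → :- (a :- b) := b :- a) refl

  sub-trans : ∀ a b c → (a ℚ.- b) ℚ.+ (b ℚ.- c) ≡ a ℚ.- c
  sub-trans = solve 3 (λ a b c → (a :- b) :+ (b :- c) := a :- c) refl

  sub-+ : ∀ a b c d →
    (a ℚ.- b) ℚ.+ (c ℚ.- d) ≡ (a ℚ.+ c) ℚ.- (b ℚ.+ d)
  sub-+ = solve 4
    (λ a b c d → (a :- b) :+ (c :- d) := (a :+ c) :- (b :+ d)) refl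

  sub-neg : ∀ a b → ℚ.- (a ℚ.- b) ≡ (ℚ.- a) ℚ.- (ℚ.- b)
  sub-neg = solve 2 (λ a b → :- (a :- b) := (:- a) :- (:- b)) refl

  sub-* : ∀ a b c d →
    a ℚ.* (c ℚ.- d) ℚ.+ d ℚ.* (a ℚ.- b) ≡ a ℚ.* c ℚ.- b ℚ.* d
  sub-* = solve 4
    (λ a b c d → a :* (c :- d) :+ d :* (a :- b) := a :* c :- b :* d) refl

open Identities

infix  8 -ℝ_
infixl 7 _*ℝ_
infixl 6 _+ℝ_

fromℚ : ℚ → ℝ
fromℚ q = mkℝ (λ _ → q) (null₂-cong (λ _ _ → sub-self q) null₂-0)

0ℝ 1ℝ : ℝ
0ℝ = fromℚ 0ℚ
1ℝ = fromℚ 1ℚ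

_+ℝ_ : ℝ → ℝ → ℝ
x +ℝ y = mkℝ (λ n → seq x n ℚ.+ seq y n)
  (null₂-cong (λ m n → sub-+ (seq x m) (seq x n) (seq y m) (seq y n))
    (null₂-+ (cauchy x) (cauchy y)))

-ℝ_ : ℝ → ℝ
-ℝ x = mkℝ (λ n → ℚ.- seq x n)
  (null₂-cong (λ m n → sub-neg (seq x m) (seq x n)) (null₂-neg (cauchy x)))

_*ℝ_ : ℝ → ℝ → ℝ
x *ℝ y = mkℝ (λ n → seq x n ℚ.* seq y n)
  (null₂-cong (λ m n → sub-* (seq x m) (seq x n) (seq y m) (seq y n))
    (null₂-+
      (null₂-* (λ m _ → m) (λ p _ → p) (bounded x) (cauchy y))
      (null₂-* (λ _ n → n) (λ _ p → p) (bounded y) (cauchy x))))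

≡⇒≈ : ∀ x y → (∀ n → seq x n ≡ seq y n) → x ≈ y
≡⇒≈ x y eq = null-cong
  (λ n → trans (sub-self (seq y n)) (cong (ℚ._- seq y n) (sym (eq n))))
  (null₂⇒null {λ _ _ → 0ℚ} null₂-0)

≈-sym : ∀ {x y} → x ≈ y → y ≈ x
≈-sym {x} {y} p = null-cong (λ n → sub-swap (seq x n) (seq y n))
  (null₂⇒null (null₂-neg (null⇒null₂ p)))

≈-trans : ∀ {x y z} → x ≈ y → y ≈ z → x ≈ z
≈-trans {x} {y} {z} p q = null-cong
  (λ n → sub-trans (seq x n) (seq y n) (seq z n))
  (null₂⇒null (null₂-+ (null⇒null₂ p) (null⇒null₂ q)))

+ℝ-cong : ∀ {x y u v} → x ≈ y → u ≈ v → (x +ℝ u) ≈ (y +ℝ v)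
+ℝ-cong {x} {y} {u} {v} p q = null-cong
  (λ n → sub-+ (seq x n) (seq y n) (seq u n) (seq v n))
  (null₂⇒null (null₂-+ (null⇒null₂ p) (null⇒null₂ q)))

-ℝ-cong : ∀ {x y} → x ≈ y → (-ℝ x) ≈ (-ℝ y)
-ℝ-cong {x} {y} p = null-cong (λ n → sub-neg (seq x n) (seq y n))
  (null₂⇒null (null₂-neg (null⇒null₂ p)))

*ℝ-cong : ∀ {x y u v} → x ≈ y → u ≈ v → (x *ℝ u) ≈ (y *ℝ v)
*ℝ-cong {x} {y} {u} {v} p q = null-cong
  (λ n → sub-* (seq x n) (seq y n) (seq u n) (seq v n))
  (null₂⇒null (null₂-+
    (null₂-* (λ m _ → m) (λ r _ → r) (bounded x) (null⇒null₂ q))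
    (null₂-* (λ m _ → m) (λ r _ → r) (bounded v) (null⇒null₂ p))))

ℝ-isCommutativeRing : IsCommutativeRing _≈_ _+ℝ_ _*ℝ_ -ℝ_ 0ℝ 1ℝ
ℝ-isCommutativeRing = record
  { isRing = record
    { +-isAbelianGroup = record
      { isGroup = record
        { isMonoid = record
          { isSemigroup = record
            { isMagma = record
              { isEquivalence = record
                { refl  = λ {x} → ≡⇒≈ x x (λ _ → refl)
                ; sym   = λ {x y} → ≈-sym {x} {y}
                ; trans = λ {x y z} → ≈-trans {x} {y} {z}
                }
              ; ∙-cong = λ {x y u v} → +ℝ-cong {x} {y} {u} {v}
              }
            ; assoc = λ x y z → ≡⇒≈ ((x +ℝ y) +ℝ z) (x +ℝ (y +ℝ z))
                (λ n → ℚ.+-assoc (seq x n) (seq y n) (seq z n))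
            }
          ; identity =
              (λ x → ≡⇒≈ (0ℝ +ℝ x) x (λ n → ℚ.+-identityˡ (seq x n)))
            , (λ x → ≡⇒≈ (x +ℝ 0ℝ) x (λ n → ℚ.+-identityʳ (seq x n)))
          }
        ; inverse =
            (λ x → ≡⇒≈ ((-ℝ x) +ℝ x) 0ℝ (λ n → ℚ.+-inverseˡ (seq x n)))
          , (λ x → ≡⇒≈ (x +ℝ (-ℝ x)) 0ℝ (λ n → ℚ.+-inverseʳ (seq x n)))
        ; ⁻¹-cong = λ {x y} → -ℝ-cong {x} {y}
        }
      ; comm = λ x y → ≡⇒≈ (x +ℝ y) (y +ℝ x)
          (λ n → ℚ.+-comm (seq x n) (seq y n))
      }
    ; *-cong = λ {x y u v} → *ℝ-cong {x} {y} {u} {v}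
    ; *-assoc = λ x y z → ≡⇒≈ ((x *ℝ y) *ℝ z) (x *ℝ (y *ℝ z))
        (λ n → ℚ.*-assoc (seq x n) (seq y n) (seq z n))
    ; *-identity =
        (λ x → ≡⇒≈ (1ℝ *ℝ x) x (λ n → ℚ.*-identityˡ (seq x n)))
      , (λ x → ≡⇒≈ (x *ℝ 1ℝ) x (λ n → ℚ.*-identityʳ (seq x n)))
    ; distrib =
        (λ x y z → ≡⇒≈ (x *ℝ (y +ℝ z)) ((x *ℝ y) +ℝ (x *ℝ z))
          (λ n → ℚ.*-distribˡ-+ (seq x n) (seq y n) (seq z n)))
      , (λ x y z → ≡⇒≈ ((y +ℝ z) *ℝ x) ((y *ℝ x) +ℝ (z *ℝ x))
          (λ n → ℚ.*-distribʳ-+ (seq x n) (seq y n) (seq z n)))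
    }
  ; *-comm = λ x y → ≡⇒≈ (x *ℝ y) (y *ℝ x)
      (λ n → ℚ.*-comm (seq x n) (seq y n))
  }

ℝ-commutativeRing : CommutativeRing 0ℓ 0ℓ
ℝ-commutativeRing = record { isCommutativeRing = ℝ-isCommutativeRing }

module Matrices {c ℓ : Level} (R : CommutativeRing c ℓ) where

  private module R = CommutativeRing R
  open R using (Carrier; 0#; 1#) renaming (_≈_ to _≈ᴿ_)
  open import Algebra.Properties.Monoid.Sum R.+-monoid using (sum)
  open import Algebra.Properties.Semiring.Exp R.semiring using (_^_)

  infixl 7 _*ᴹ_ _*ᵛ_
  infix  4 _≈ᴹ_

  Matrix : ℕ → Set c
  Matrix n = Fin n → Fin n → Carrier

  _≈ᴹ_ : ∀ {n} → Rel (Matrix n) ℓ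
  A ≈ᴹ B = ∀ i j → A i j ≈ᴿ B i j

  1ᴹ : ∀ {n} → Matrix n
  1ᴹ i j = if does (i ≟ j) then 1# else 0#

  _*ᴹ_ : ∀ {n} → Matrix n → Matrix n → Matrix n
  (A *ᴹ B) i j = sum (λ k → A i k R.* B k j)

  _*ᵛ_ : ∀ {n} → Matrix n → Vector Carrier n → Vector Carrier n
  (A *ᵛ x) i = sum (λ j → A i j R.* x j)

  minor : ∀ {n} → Matrix n → Fin n → Fin n → Matrix (pred n)
  minor {suc n} A i j k l = A (punchIn i k) (punchIn j l)

  sign : ℕ → Carrier
  sign k = (R.- 1#) ^ k

  -- Laplace expansion along the first row.
  det : ∀ {n} → Matrix n → Carrier
  det {zero}  A = 1#
  det {suc n} A =
    sum (λ j → sign (toℕ j) R.* (A Fin.zero j R.* det {n} (minor A Fin.zero j)))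

  -- The transpose of the cofactor matrix.
  adjugate : ∀ {n} → Matrix n → Matrix n
  adjugate A i j = sign (toℕ i ℕ.+ toℕ j) R.* det (minor A j i)

  Nonsingular : ∀ {n} → Matrix n → Set (c ⊔ ℓ)
  Nonsingular A = ∃[ B ] (A *ᴹ B) ≈ᴹ 1ᴹ × (B *ᴹ A) ≈ᴹ 1ᴹ

  Singular : ∀ {n} → Matrix n → Set (c ⊔ ℓ)
  Singular A = ¬ Nonsingular A

  Nullspace : ∀ {n} → Matrix n → Vector Carrier n → Set ℓ
  Nullspace A x = ∀ i → (A *ᵛ x) i ≈ᴿ 0#

  lin : ∀ {k n} → Vector Carrier k → Vector (Vector Carrier n) k →
        Vector Carrier n
  lin a b i = sum (λ j → a j R.* b j i)

  record IsBasis {p n k} (V : Vector Carrier n → Set p)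
                 (b : Vector (Vector Carrier n) k) : Set (c ⊔ ℓ ⊔ p) where
    field
      members     : ∀ j → V (b j)
      independent : ∀ a → (∀ i → lin a b i ≈ᴿ 0#) → ∀ j → a j ≈ᴿ 0#
      spanning    : ∀ x → V x → ∃[ a ] ∀ i → x i ≈ᴿ lin a b i

  HasDimension : ∀ {p n} → (Vector Carrier n → Set p) → ℕ → Set (c ⊔ ℓ ⊔ p)
  HasDimension {n = n} V k =
    ∃[ b ] IsBasis {n = n} {k = k} V b

record Graph (n : ℕ) : Set₁ where
  field
    _∼_    : Rel (Fin n) 0ℓ
    _∼?_   : Decidable _∼_
    ∼-sym  : Symmetric _∼_
    ∼-irr  : Irreflexive _≡_ _∼_

-- The vertices of G ∖ v are renumbered in order, k standing for punchIn v k.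
infixl 6 _∖_
_∖_ : ∀ {n} → Graph n → Fin n → Graph (pred n)
_∖_ {suc n} G v = record
  { _∼_   = λ i j → punchIn v i ∼ punchIn v j
  ; _∼?_  = λ i j → punchIn v i ∼? punchIn v j
  ; ∼-sym = ∼-sym
  ; ∼-irr = λ i≡j → ∼-irr (cong (punchIn v) i≡j)
  }
  where open Graph G

module M = Matrices ℝ-commutativeRing

adjacency : ∀ {n} → Graph n → M.Matrix n
adjacency G i j = if does (i ∼? j) then 1ℝ else 0ℝ
  where open Graph G

detᴳ : ∀ {n} → Graph n → ℝ
detᴳ G = M.det (adjacency G)

adjᴳ : ∀ {n} → Graph n → M.Matrix n
adjᴳ G = M.adjugate (adjacency G)

Singular Nonsingular : ∀ {n} → Graph n → Set
Singular    G = M.Singular (adjacency G)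
Nonsingular G = M.Nonsingular (adjacency G)

𝒩 : ∀ {n} → Graph n → Vector ℝ n → Set
𝒩 G = M.Nullspace (adjacency G)

-- "nl G = k", as a relation: the dimension of a subspace is not a function
-- of the subspace constructively.
HasNullity : ∀ {n} → Graph n → ℕ → Set
HasNullity G k = M.HasDimension (𝒩 G) k

infix 4 _∈Supp_
_∈Supp_ : ∀ {n} → Fin n → Graph n → Set
v ∈Supp G = ∃[ x ] 𝒩 G x × x v # 0ℝ

module Submission where

-- The determinants of an adjacency matrix A and of its minors are integers, so
-- each is either zero or invertible, although the null vectors are real.
-- If nl = 1, then det A = 0, so the columns of adj A are null vectors, that is
-- multiples of a basis vector β, and adj A is symmetric of rank at most one.
-- If x is a null vector with x v ≠ 0 and A − v were singular, a rational null
-- vector of A − v, extended by 0 at v, would be a null vector of A: a multiple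
-- of β vanishing at v although β v ≠ 0.  Hence det (A − v) = adj A v v ≠ 0.
-- Column u of adj A is the multiple of x wanted in (4), where x u ≠ 0.

open import Algebra.Bundles using (CommutativeRing)
open import Data.Bool.Base using (if_then_else_)
open import Data.Fin.Base using (Fin; zero; suc; toℕ; punchIn; punchOut; pinch; _↑ˡ_)
open import Data.Fin.Properties
  using (_≟_; any?; punchIn-punchOut; punchOut-injective; punchInᵢ≢i)
open import Data.Nat.Base as ℕ using (ℕ; zero; suc)
import Data.Nat.Properties as ℕ
open import Data.Product.Base using (∃-syntax; _×_; _,_; proj₁; proj₂)
open import Data.Product.Function.NonDependent.Propositional using (_×-⇔_)
open import Data.Rational.Base as ℚ using (ℚ; 0ℚ; 1ℚ; ½; ∣_∣)
import Data.Rational.Properties as ℚ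
open import Data.Rational.Solver using (module +-*-Solver)
open import Data.Sum.Base using (_⊎_; inj₁; inj₂)
open import Data.Vec.Functional as Vector using (Vector; updateAt; insertAt)
open import Data.Vec.Functional.Properties
  using (updateAt-updates; updateAt-minimal; insertAt-lookup; insertAt-punchIn; lookup-++ˡ)
open import Defs using (module Matrices)
open import Function.Base using (_∘_)
open import Function.Bundles using (_⇔_; mk⇔)
open import Function.Construct.Composition using (_⇔-∘_)
open import Function.Construct.Symmetry using (⇔-sym)
open import Level using (Level; 0ℓ; _⊔_)
open import Relation.Binary.PropositionalEquality as ≡ using (_≡_; _≢_)
open import Relation.Nullary.Decidable using (yes; no; dec-true; dec-false)
open import Relation.Nullary.Negation using (¬_; contradiction)

-- Deleting two positions of a finite set.

punchIn-pinch : ∀ {n} (j : Fin (suc n)) (i : Fin n) → punchIn (punchIn j i) (pinch i j) ≡ j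
punchIn-pinch zero    zero    = ≡.refl
punchIn-pinch zero    (suc i) = ≡.refl
punchIn-pinch (suc j) zero    = ≡.refl
punchIn-pinch (suc j) (suc i) = ≡.cong suc (punchIn-pinch j i)

-- Rows `j` and `punchIn j i` may be deleted in either order: once `punchIn j i` has gone, row `j`
-- sits at `pinch i j`. This identifies the iterated minors of the two expansions compared in
-- `laplace`.
punchIn-punchIn-pinch : ∀ {n} (j : Fin (suc (suc n))) (i : Fin (suc n)) (k : Fin n) →
  punchIn (punchIn j i) (punchIn (pinch i j) k) ≡ punchIn j (punchIn i k)
punchIn-punchIn-pinch zero    zero    k       = ≡.refl
punchIn-punchIn-pinch zero    (suc i) k       = ≡.refl
punchIn-punchIn-pinch (suc j) zero    k       = ≡.refl
punchIn-punchIn-pinch (suc j) (suc i) zero    = ≡.refl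
punchIn-punchIn-pinch (suc j) (suc i) (suc k) = ≡.cong suc (punchIn-punchIn-pinch j i k)

-- Supplies a row to expand along when rows `p` and `q` are to survive in every minor.
avoid-two : ∀ {n} (p q : Fin (suc (suc (suc n)))) → ∃[ r ] r ≢ p × r ≢ q
avoid-two zero          zero          = suc zero       , (λ ()) , (λ ())
avoid-two zero          (suc zero)    = suc (suc zero) , (λ ()) , (λ ())
avoid-two zero          (suc (suc q)) = suc zero       , (λ ()) , (λ ())
avoid-two (suc zero)    zero          = suc (suc zero) , (λ ()) , (λ ())
avoid-two (suc (suc p)) zero          = suc zero       , (λ ()) , (λ ())
avoid-two (suc p)       (suc q)       = zero           , (λ ()) , (λ ())

module Determinants {c ℓ : Level} (R : CommutativeRing c ℓ) where

  open CommutativeRing R hiding (zero)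
  open Matrices R
  open import Algebra.Properties.AbelianGroup +-abelianGroup using (⁻¹-involutive)
  open import Algebra.Properties.Ring ring using (-1*x≈-x)
  open import Algebra.Properties.Semiring.Exp semiring using (^-homo-*)
  open import Algebra.Properties.Semiring.Sum semiring
    using (sum; sum-cong-≋; sum-replicate-zero; sum-remove; ∑-comm;
           *-distribˡ-sum; *-distribʳ-sum)
  open import Algebra.Solver.Ring.NaturalCoefficients.Default commutativeSemiring
    using (solve; _:+_; _:*_; _:=_; con)
  open import Relation.Binary.Reasoning.Setoid setoid

  -- Double sums and signs.

  _ᵀ : ∀ {n} → Matrix n → Matrix n
  (A ᵀ) i j = A j i

  sum-zero : ∀ {n} {t : Vector Carrier n} → (∀ i → t i ≈ 0#) → sum t ≈ 0#
  sum-zero {n} t≈0 = trans (sum-cong-≋ t≈0) (sum-replicate-zero n)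

  weighted-sum-cong : ∀ {n} (s x : Vector Carrier n) {d e : Vector Carrier n} →
    (∀ i → d i ≈ e i) → sum (λ i → s i * (x i * d i)) ≈ sum (λ i → s i * (x i * e i))
  weighted-sum-cong s x d≈e = sum-cong-≋ λ i → *-congˡ {s i} (*-congˡ {x i} (d≈e i))

  -- Two iterated expansions of a determinant are double sums; interchanging the summations and
  -- matching terms is the step common to the column expansion and to `laplace`.
  exchange : ∀ {m n} (u x : Vector Carrier m) (v y : Vector Carrier n)
             (f g : Fin m → Fin n → Carrier) →
             (∀ i j → u i * (x i * f i j) ≈ v j * (y j * g i j)) →
             sum (λ i → u i * (x i * sum (f i))) ≈
             sum (λ j → v j * (y j * sum (λ i → g i j)))
  exchange u x v y f g eq = begin
    sum (λ i → u i * (x i * sum (f i)))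
      ≈⟨ sum-cong-≋ (λ i → distrib² (u i) (x i) (f i)) ⟩
    sum (λ i → sum (λ j → u i * (x i * f i j)))
      ≈⟨ ∑-comm (λ i j → u i * (x i * f i j)) ⟩
    sum (λ j → sum (λ i → u i * (x i * f i j)))
      ≈⟨ sum-cong-≋ (λ j → sum-cong-≋ (λ i → eq i j)) ⟩
    sum (λ j → sum (λ i → v j * (y j * g i j)))
      ≈⟨ sum-cong-≋ (λ j → distrib² (v j) (y j) (λ i → g i j)) ⟨
    sum (λ j → v j * (y j * sum (λ i → g i j))) ∎
    where
    distrib² : ∀ {k} a b (t : Vector Carrier k) →
               a * (b * sum t) ≈ sum (λ i → a * (b * t i))
    distrib² a b t = trans (*-congˡ (*-distribˡ-sum b t)) (*-distribˡ-sum a (λ i → b * t i))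

  -1*-1≈1 : - 1# * - 1# ≈ 1#
  -1*-1≈1 = trans (-1*x≈-x (- 1#)) (⁻¹-involutive 1#)

  sign-+ : ∀ m n → sign (m ℕ.+ n) ≈ sign m * sign n
  sign-+ = ^-homo-* (- 1#)

  sign² : ∀ m → sign m * sign m ≈ 1#
  sign² zero    = *-identityˡ 1#
  sign² (suc m) = begin
    (- 1# * sign m) * (- 1# * sign m)
      ≈⟨ solve 2 (λ e s → (e :* s) :* (e :* s) := (e :* e) :* (s :* s)) refl (- 1#) (sign m) ⟩
    (- 1# * - 1#) * (sign m * sign m) ≈⟨ *-cong -1*-1≈1 (sign² m) ⟩
    1# * 1#                           ≈⟨ *-identityˡ 1# ⟩
    1#                                ∎

  sign-double : ∀ m → sign (m ℕ.+ m) ≈ 1#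
  sign-double m = trans (sign-+ m m) (sign² m)

  -- Laplace expansions.

  det-cong : ∀ {n} {A B : Matrix n} → A ≈ᴹ B → det A ≈ det B
  det-cong {zero}  A≈B = refl
  det-cong {suc n} A≈B = sum-cong-≋ λ j → *-congˡ {sign (toℕ j)}
    (*-cong (A≈B zero j) (det-cong (λ k l → A≈B (suc k) (punchIn j l))))

  -- The corner term is common to both expansions. Induction expands the other first-row minors
  -- along their first column; after the interchange, the inner sums are by definition the first-row
  -- expansions of the minors along column zero.
  det-expand-column : ∀ {n} (A : Matrix (suc n)) →
    det A ≈ sum (λ i → sign (toℕ i) * (A i zero * det (minor A i zero)))
  det-expand-column {zero}  A = refl
  det-expand-column {suc n} A = +-congˡ (begin
    sum (λ j → sign (suc (toℕ j)) * (A zero (suc j) * det (minor A zero (suc j))))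
      ≈⟨ weighted-sum-cong (λ j → sign (suc (toℕ j))) (λ j → A zero (suc j))
           (λ j → det-expand-column (minor A zero (suc j))) ⟩
    sum (λ j → sign (suc (toℕ j)) * (A zero (suc j) *
      sum (λ i → sign (toℕ i) * (A (suc i) zero * D i j))))
      ≈⟨ exchange (λ j → sign (suc (toℕ j))) (λ j → A zero (suc j))
                  (λ i → sign (suc (toℕ i))) (λ i → A (suc i) zero)
                  (λ j i → sign (toℕ i) * (A (suc i) zero * D i j))
                  (λ j i → sign (toℕ j) * (A zero (suc j) * D i j))
                  (λ j i → reorder (- 1#) (sign (toℕ j)) (A zero (suc j))
                                   (sign (toℕ i)) (A (suc i) zero) (D i j)) ⟩
    sum (λ i → sign (suc (toℕ i)) * (A (suc i) zero *
      sum (λ j → sign (toℕ j) * (A zero (suc j) * D i j)))) ∎)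
    where
    D : Fin (suc n) → Fin (suc n) → Carrier
    D i j = det (minor (minor A zero (suc j)) i zero)
    reorder : ∀ e s a t b d → (e * s) * (a * (t * (b * d))) ≈ (e * t) * (b * (s * (a * d)))
    reorder = solve 6 (λ e s a t b d →
      (e :* s) :* (a :* (t :* (b :* d))) := (e :* t) :* (b :* (s :* (a :* d)))) refl

  -- The first-row expansion of the transpose is the first-column expansion of `A` with transposed
  -- minors, to which induction applies.
  det-transpose : ∀ {n} (A : Matrix n) → det (A ᵀ) ≈ det A
  det-transpose {zero}  A = refl
  det-transpose {suc n} A = begin
    det (A ᵀ)
      ≈⟨ weighted-sum-cong (λ j → sign (toℕ j)) (λ j → A j zero)
           (λ j → det-transpose {n} (minor A j zero)) ⟩
    sum (λ j → sign (toℕ j) * (A j zero * det (minor A j zero)))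
      ≈⟨ det-expand-column A ⟨
    det A ∎

  -- If `i` lies below `j`, then `punchIn j i` and `pinch i j` are `i` and `j - 1`; otherwise they
  -- are `i + 1` and `j`. Either way the total of the two indices changes by one.
  sign-punchIn-pinch : ∀ {n} (j : Fin (suc n)) (i : Fin n) →
    sign (toℕ (punchIn j i)) * sign (toℕ (pinch i j)) ≈ - 1# * (sign (toℕ j) * sign (toℕ i))
  sign-punchIn-pinch zero    zero    = *-assoc _ _ _
  sign-punchIn-pinch zero    (suc i) =
    solve 2 (λ e s → (e :* s) :* con 1 := e :* (con 1 :* s)) refl (- 1#) (sign (suc (toℕ i)))
  sign-punchIn-pinch (suc j) zero    = begin
    1# * sign (toℕ j)                    ≈⟨ *-congʳ -1*-1≈1 ⟨
    (- 1# * - 1#) * sign (toℕ j)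
      ≈⟨ solve 2 (λ e s → (e :* e) :* s := e :* ((e :* s) :* con 1)) refl (- 1#) (sign (toℕ j)) ⟩
    - 1# * (sign (suc (toℕ j)) * 1#)     ∎
  sign-punchIn-pinch (suc j) (suc i) = begin
    (- 1# * s) * (- 1# * t)             ≈⟨ regroup (- 1#) s t ⟩
    (- 1# * - 1#) * (s * t)             ≈⟨ *-congˡ (sign-punchIn-pinch j i) ⟩
    (- 1# * - 1#) * (- 1# * (u * v))    ≈⟨ solve 3 (λ e u v →
                                               (e :* e) :* (e :* (u :* v)) := e :* ((e :* u) :* (e :* v)))
                                             refl (- 1#) u v ⟩
    - 1# * ((- 1# * u) * (- 1# * v))    ∎
    where
    s = sign (toℕ (punchIn j i))
    t = sign (toℕ (pinch i j))
    u = sign (toℕ j)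
    v = sign (toℕ i)
    regroup : ∀ e s t → (e * s) * (e * t) ≈ (e * e) * (s * t)
    regroup = solve 3 (λ e s t → (e :* s) :* (e :* t) := (e :* e) :* (s :* t)) refl

  -- Expanding the other rows' terms of the first-column expansion along the
  -- row j, which has become row pinch i j of the minor without row punchIn j i,
  -- gives the same double sum as expanding the row-j minors along column 0.
  laplace : ∀ {n} (A : Matrix (suc n)) (j : Fin (suc n)) →
    det A ≈ sum (λ k → sign (toℕ j ℕ.+ toℕ k) * (A j k * det (minor A j k)))
  laplace {zero}  A zero = refl
  laplace {suc n} A j    = begin
    det A
      ≈⟨ det-expand-column A ⟩
    sum term
      ≈⟨ sum-remove {i = j} term ⟩
    term j + sum (λ i → sign (toℕ (p i)) * (A (p i) zero * det (minor A (p i) zero)))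
      ≈⟨ +-cong (*-congʳ (reflexive (≡.cong sign (≡.sym (ℕ.+-identityʳ (toℕ j)))))) (begin
        sum (λ i → sign (toℕ (p i)) * (A (p i) zero * det (minor A (p i) zero)))
          ≈⟨ weighted-sum-cong (λ i → sign (toℕ (p i))) (λ i → A (p i) zero) expand ⟩
        sum (λ i → sign (toℕ (p i)) * (A (p i) zero *
          sum (λ l → sign (toℕ (q i) ℕ.+ toℕ l) * (A j (suc l) * D i l))))
          ≈⟨ exchange (λ i → sign (toℕ (p i))) (λ i → A (p i) zero)
                      (λ l → sign (toℕ j ℕ.+ suc (toℕ l))) (λ l → A j (suc l))
                      (λ i l → sign (toℕ (q i) ℕ.+ toℕ l) * (A j (suc l) * D i l))
                      (λ i l → sign (toℕ i) * (A (p i) zero * D i l))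
                      swap ⟩
        sum (λ l → sign (toℕ j ℕ.+ suc (toℕ l)) * (A j (suc l) *
          sum (λ i → sign (toℕ i) * (A (p i) zero * D i l))))
          ≈⟨ weighted-sum-cong (λ l → sign (toℕ j ℕ.+ suc (toℕ l))) (λ l → A j (suc l))
               (λ l → det-expand-column (minor A j (suc l))) ⟨
        sum (λ l → sign (toℕ j ℕ.+ suc (toℕ l)) * (A j (suc l) * det (minor A j (suc l))))
        ∎) ⟩
    sum (λ k → sign (toℕ j ℕ.+ toℕ k) * (A j k * det (minor A j k))) ∎
    where
    term : Vector Carrier (suc (suc n))
    term i = sign (toℕ i) * (A i zero * det (minor A i zero))
    p : Fin (suc n) → Fin (suc (suc n))
    p = punchIn j
    q : Fin (suc n) → Fin (suc n)
    q i = pinch i j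
    D : Fin (suc n) → Fin (suc n) → Carrier
    D i l = det (minor (minor A j (suc l)) i zero)
    expand : ∀ i → det (minor A (p i) zero) ≈
      sum (λ l → sign (toℕ (q i) ℕ.+ toℕ l) * (A j (suc l) * D i l))
    expand i = trans (laplace (minor A (p i) zero) (q i)) (sum-cong-≋ λ l →
      *-congˡ {sign (toℕ (q i) ℕ.+ toℕ l)} (*-cong
        (reflexive (≡.cong (λ r → A r (suc l)) (punchIn-pinch j i)))
        (det-cong λ r s → reflexive
          (≡.cong (λ k → A k (suc (punchIn l s))) (punchIn-punchIn-pinch j i r)))))
    swap : ∀ i l →
      sign (toℕ (p i)) * (A (p i) zero * (sign (toℕ (q i) ℕ.+ toℕ l) * (A j (suc l) * D i l))) ≈
      sign (toℕ j ℕ.+ suc (toℕ l)) * (A j (suc l) * (sign (toℕ i) * (A (p i) zero * D i l)))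
    swap i l = begin
      σp * (a * (sign (toℕ (q i) ℕ.+ toℕ l) * (b * d)))
        ≈⟨ *-congˡ (*-congˡ (*-congʳ (sign-+ (toℕ (q i)) (toℕ l)))) ⟩
      σp * (a * ((σq * σl) * (b * d)))
        ≈⟨ solve 6 (λ p q l a b d →
             p :* (a :* ((q :* l) :* (b :* d))) := (p :* q) :* (l :* (a :* (b :* d))))
             refl σp σq σl a b d ⟩
      (σp * σq) * (σl * (a * (b * d)))
        ≈⟨ *-congʳ (sign-punchIn-pinch j i) ⟩
      (- 1# * (σj * σi)) * (σl * (a * (b * d)))
        ≈⟨ solve 7 (λ e j i l a b d →
             (e :* (j :* i)) :* (l :* (a :* (b :* d))) := (j :* (e :* l)) :* (b :* (i :* (a :* d))))
             refl (- 1#) σj σi σl a b d ⟩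
      (σj * (- 1# * σl)) * (b * (σi * (a * d)))
        ≈⟨ *-congʳ (sign-+ (toℕ j) (suc (toℕ l))) ⟨
      sign (toℕ j ℕ.+ suc (toℕ l)) * (b * (σi * (a * d))) ∎
      where
      σp = sign (toℕ (p i))
      σq = sign (toℕ (q i))
      σl = sign (toℕ l)
      σj = sign (toℕ j)
      σi = sign (toℕ i)
      a = A (p i) zero
      b = A j (suc l)
      d = D i l

  -- Equal rows, cofactors and selections of rows.

  det₂-equal-rows : (A : Matrix 2) → (∀ k → A zero k ≈ A (suc zero) k) → det A ≈ 0#
  det₂-equal-rows A eq = begin
    det A
      ≈⟨ +-congˡ (+-congʳ (*-congˡ {sign 1} (*-congˡ (+-congʳ (*-congˡ (*-congʳ (eq zero))))))) ⟨
    1# * (a * (1# * (A (suc zero) (suc zero) * 1#) + 0#)) + (- 1# * 1# * (b * (1# * (a * 1#) + 0#)) + 0#)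
      ≈⟨ +-congʳ (*-congˡ (*-congˡ (+-congʳ (*-congˡ (*-congʳ (eq (suc zero))))))) ⟨
    1# * (a * (1# * (b * 1#) + 0#)) + (- 1# * 1# * (b * (1# * (a * 1#) + 0#)) + 0#)
      ≈⟨ solve 3 (λ e a b →
           con 1 :* (a :* (con 1 :* (b :* con 1) :+ con 0)) :+
           (e :* con 1 :* (b :* (con 1 :* (a :* con 1) :+ con 0)) :+ con 0)
           := (e :+ con 1) :* (a :* b)) refl (- 1#) a b ⟩
    (- 1# + 1#) * (a * b) ≈⟨ *-congʳ (-‿inverseˡ 1#) ⟩
    0# * (a * b)          ≈⟨ zeroˡ _ ⟩
    0#                    ∎
    where
    a = A zero zero
    b = A zero (suc zero)

  -- Expanding along a third row keeps both equal rows in every minor, so induction applies; with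
  -- only two rows the determinant is computed outright.
  det-equal-rows : ∀ {n} (A : Matrix n) {p q} → p ≢ q → (∀ k → A p k ≈ A q k) → det A ≈ 0#
  det-equal-rows {suc zero} A {zero} {zero} p≢q eq = contradiction ≡.refl p≢q
  det-equal-rows {suc (suc zero)} A {zero} {zero} p≢q eq = contradiction ≡.refl p≢q
  det-equal-rows {suc (suc zero)} A {zero} {suc zero} p≢q eq = det₂-equal-rows A eq
  det-equal-rows {suc (suc zero)} A {suc zero} {zero} p≢q eq = det₂-equal-rows A (sym ∘ eq)
  det-equal-rows {suc (suc zero)} A {suc zero} {suc zero} p≢q eq = contradiction ≡.refl p≢q
  det-equal-rows {suc (suc (suc n))} A {p} {q} p≢q eq =
    let r , r≢p , r≢q = avoid-two p q in
    trans (laplace A r) (sum-zero λ k →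
      trans (*-congˡ {sign (toℕ r ℕ.+ toℕ k)} (trans (*-congˡ {A r k}
        (det-equal-rows {suc (suc n)} (minor A r k) {punchOut r≢p} {punchOut r≢q}
          (p≢q ∘ punchOut-injective r≢p r≢q)
          (λ l → trans (minor-row r≢p k l) (trans (eq (punchIn k l)) (sym (minor-row r≢q k l))))))
        (zeroʳ _))) (zeroʳ _))
    where
    minor-row : ∀ {r i} (r≢i : r ≢ i) k l → minor A r k (punchOut r≢i) l ≈ A i (punchIn k l)
    minor-row r≢i k l = reflexive (≡.cong (λ i → A i (punchIn k l)) (punchIn-punchOut r≢i))

  cofactors-own-row : ∀ {n} (A : Matrix n) j → (A *ᴹ adjugate A) j j ≈ det A
  cofactors-own-row {suc n} A j = begin
    sum (λ k → A j k * (sign (toℕ k ℕ.+ toℕ j) * det (minor A j k)))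
      ≈⟨ sum-cong-≋ (λ k → trans (swap (A j k) (sign (toℕ k ℕ.+ toℕ j)) (det (minor A j k)))
           (*-congʳ {A j k * det (minor A j k)} (reflexive (≡.cong sign (ℕ.+-comm (toℕ k) (toℕ j)))))) ⟩
    sum (λ k → sign (toℕ j ℕ.+ toℕ k) * (A j k * det (minor A j k)))
      ≈⟨ laplace A j ⟨
    det A ∎
    where
    swap : ∀ a s d → a * (s * d) ≈ s * (a * d)
    swap = solve 3 (λ a s d → a :* (s :* d) := s :* (a :* d)) refl

  -- Overwriting row `j` by row `i` leaves the cofactors of row `j` unchanged, so the entry is the
  -- determinant of a matrix with two equal rows.
  cofactors-alien-row : ∀ {n} (A : Matrix n) {i j} → i ≢ j → (A *ᴹ adjugate A) i j ≈ 0#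
  cofactors-alien-row {suc n} A {i} {j} i≢j = begin
    (A *ᴹ adjugate A) i j
      ≈⟨ sum-cong-≋ (λ k → *-cong {A i k} {B j k} {adjugate A k j} {adjugate B k j}
           (reflexive (≡.cong (λ r → r k) (≡.sym row-j)))
           (*-congˡ {sign (toℕ k ℕ.+ toℕ j)} (det-cong λ r s → reflexive
             (≡.cong (λ r → r (punchIn k s))
               (≡.sym (updateAt-minimal (punchIn j r) j A (punchInᵢ≢i j r))))))) ⟩
    (B *ᴹ adjugate B) j j
      ≈⟨ cofactors-own-row B j ⟩
    det B
      ≈⟨ det-equal-rows B i≢j (λ k → reflexive
           (≡.cong (λ r → r k) (≡.trans (updateAt-minimal i j A i≢j) (≡.sym row-j)))) ⟩
    0# ∎
    where
    B : Matrix (suc n)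
    B = updateAt A j (λ _ → A i)
    row-j : B j ≡ A i
    row-j = updateAt-updates j A

  bilinear-assoc : ∀ {m n} (x : Vector Carrier m) (A : Fin m → Vector Carrier n) (y : Vector Carrier n) →
    sum (λ i → x i * sum (λ j → A i j * y j)) ≈ sum (λ j → sum (λ i → x i * A i j) * y j)
  bilinear-assoc x A y = begin
    sum (λ i → x i * sum (λ j → A i j * y j))
      ≈⟨ sum-cong-≋ (λ i → *-distribˡ-sum (x i) (λ j → A i j * y j)) ⟩
    sum (λ i → sum (λ j → x i * (A i j * y j)))
      ≈⟨ ∑-comm (λ i j → x i * (A i j * y j)) ⟩
    sum (λ j → sum (λ i → x i * (A i j * y j)))
      ≈⟨ sum-cong-≋ (λ j → sum-cong-≋ (λ i → *-assoc (x i) (A i j) (y j))) ⟨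
    sum (λ j → sum (λ i → (x i * A i j) * y j))
      ≈⟨ sum-cong-≋ (λ j → *-distribʳ-sum (y j) (λ i → x i * A i j)) ⟨
    sum (λ j → sum (λ i → x i * A i j) * y j) ∎

  sum-single : ∀ {n} (t : Vector Carrier n) i → (∀ {j} → j ≢ i → t j ≈ 0#) → sum t ≈ t i
  sum-single {suc n} t i t≈0 = begin
    sum t                               ≈⟨ sum-remove {i = i} t ⟩
    t i + sum (λ j → t (punchIn i j))   ≈⟨ +-congˡ (sum-zero (λ j → t≈0 (punchInᵢ≢i i j))) ⟩
    t i + 0#                            ≈⟨ +-identityʳ (t i) ⟩
    t i                                 ∎

  -- Since `A *ᴹ adjugate A` is `det A` times the identity, `y j * det A` is an entry of the row
  -- vector `y` times this product, and reassociating brings in `y` times `A`, which vanishes.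
  left-null-det : ∀ {n} (A : Matrix n) (y : Vector Carrier n) →
    (∀ k → sum (λ i → y i * A i k) ≈ 0#) → ∀ j → y j * det A ≈ 0#
  left-null-det A y yA≈0 j = begin
    y j * det A
      ≈⟨ *-congˡ (cofactors-own-row A j) ⟨
    y j * (A *ᴹ adjugate A) j j
      ≈⟨ sum-single (λ i → y i * (A *ᴹ adjugate A) i j) j (λ {i} i≢j →
           trans (*-congˡ {y i} (cofactors-alien-row A i≢j)) (zeroʳ _)) ⟨
    sum (λ i → y i * (A *ᴹ adjugate A) i j)
      ≈⟨ bilinear-assoc y A (λ k → adjugate A k j) ⟩
    sum (λ k → sum (λ i → y i * A i k) * adjugate A k j)
      ≈⟨ sum-zero (λ k → trans (*-congʳ {adjugate A k j} (yA≈0 k)) (zeroˡ _)) ⟩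
    0# ∎

  -- The factor `ε` is the sign of `f` if `f` is a permutation and zero otherwise. A repetition of
  -- the first value gives equal rows; otherwise that value is removed from the range and induction
  -- handles the tail.
  det-select-rows : ∀ {n} (f : Fin n → Fin n) →
    ∃[ ε ] (∀ A → det (λ k → A (f k)) ≈ ε * det A)
  det-select-rows {zero}  f = 1# , λ A → sym (*-identityˡ 1#)
  det-select-rows {suc n} f with any? (λ i → f zero ≟ f (suc i))
  ... | yes (i , f0≡fi) = 0# , λ A → trans
    (det-equal-rows (λ k → A (f k)) {zero} {suc i} (λ ())
      (λ k → reflexive (≡.cong (λ r → A r k) f0≡fi)))
    (sym (zeroˡ _))
  ... | no f0∉ = ε * sign (toℕ (f zero)) , λ A → begin
    det (λ k → A (f k))
      ≈⟨ weighted-sum-cong (λ j → sign (toℕ j)) (A (f zero)) (tail-minor A) ⟩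
    sum (λ j → sign (toℕ j) * (A (f zero) j * (ε * det (minor A (f zero) j))))
      ≈⟨ sum-cong-≋ (λ j → resign (A (f zero) j) (det (minor A (f zero) j)) (toℕ j)) ⟩
    sum (λ j → (ε * sign (toℕ (f zero))) *
      (sign (toℕ (f zero) ℕ.+ toℕ j) * (A (f zero) j * det (minor A (f zero) j))))
      ≈⟨ *-distribˡ-sum (ε * sign (toℕ (f zero)))
           (λ j → sign (toℕ (f zero) ℕ.+ toℕ j) * (A (f zero) j * det (minor A (f zero) j))) ⟨
    (ε * sign (toℕ (f zero))) *
      sum (λ j → sign (toℕ (f zero) ℕ.+ toℕ j) * (A (f zero) j * det (minor A (f zero) j)))
      ≈⟨ *-congˡ (laplace A (f zero)) ⟨
    (ε * sign (toℕ (f zero))) * det A ∎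
    where
    f0≢ : ∀ k → f zero ≢ f (suc k)
    f0≢ k f0≡fk = f0∉ (k , f0≡fk)
    IH = det-select-rows (λ k → punchOut (f0≢ k))
    ε = proj₁ IH
    tail-minor : ∀ A j → det (λ k l → A (f (suc k)) (punchIn j l)) ≈ ε * det (minor A (f zero) j)
    tail-minor A j = trans
      (det-cong λ k l → reflexive
        (≡.cong (λ r → A r (punchIn j l)) (≡.sym (punchIn-punchOut (f0≢ k)))))
      (proj₂ IH (minor A (f zero) j))
    resign : ∀ a d m → sign m * (a * (ε * d)) ≈
      (ε * sign (toℕ (f zero))) * (sign (toℕ (f zero) ℕ.+ m) * (a * d))
    resign a d m = begin
      sign m * (a * (ε * d))
        ≈⟨ solve 4 (λ s a e d →
             s :* (a :* (e :* d)) := con 1 :* (e :* (s :* (a :* d))))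
             refl (sign m) a ε d ⟩
      1# * (ε * (sign m * (a * d)))
        -- The sign of row `f zero` is inserted twice: one copy goes into the constant factor, the
        -- other turns the signs of the first row into those of row `f zero`.
        ≈⟨ *-congʳ (sign² (toℕ (f zero))) ⟨
      (σ * σ) * (ε * (sign m * (a * d)))
        ≈⟨ solve 5 (λ s a e d t →
             (t :* t) :* (e :* (s :* (a :* d))) := (e :* t) :* ((t :* s) :* (a :* d)))
             refl (sign m) a ε d σ ⟩
      (ε * σ) * ((σ * sign m) * (a * d))
        ≈⟨ *-congˡ (*-congʳ (sign-+ (toℕ (f zero)) m)) ⟨
      (ε * σ) * (sign (toℕ (f zero) ℕ.+ m) * (a * d)) ∎
      where
      σ = sign (toℕ (f zero))

  -- Units, and subrings whose elements are zero or invertible.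

  Unit : Carrier → Set (c ⊔ ℓ)
  Unit x = ∃[ y ] x * y ≈ 1#

  unit-cong : ∀ {x y} → x ≈ y → Unit x → Unit y
  unit-cong x≈y (z , xz≈1) = z , trans (*-congʳ (sym x≈y)) xz≈1

  unit-* : ∀ {x y} → Unit x → Unit y → Unit (x * y)
  unit-* {x} {y} (u , xu≈1) (v , yv≈1) = u * v , (begin
    (x * y) * (u * v) ≈⟨ solve 4 (λ x y u v → (x :* y) :* (u :* v) := (x :* u) :* (y :* v)) refl x y u v ⟩
    (x * u) * (y * v) ≈⟨ *-cong xu≈1 yv≈1 ⟩
    1# * 1#           ≈⟨ *-identityˡ 1# ⟩
    1#                ∎)

  unit-*ʳ : ∀ {x y} → Unit (x * y) → Unit y
  unit-*ʳ {x} {y} (z , xyz≈1) = x * z , trans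
    (solve 3 (λ x y z → y :* (x :* z) := (x :* y) :* z) refl x y z) xyz≈1

  unit-*ˡ : ∀ {x y} → Unit (x * y) → Unit x
  unit-*ˡ {x} {y} u = unit-*ʳ {y} {x} (unit-cong (*-comm x y) u)

  unit-sign : ∀ m → Unit (sign m)
  unit-sign m = sign m , sign² m

  unit-cancelʳ : ∀ {x y} → Unit y → x * y ≈ 0# → x ≈ 0#
  unit-cancelʳ {x} {y} (z , yz≈1) xy≈0 = begin
    x           ≈⟨ *-identityʳ x ⟨
    x * 1#      ≈⟨ *-congˡ yz≈1 ⟨
    x * (y * z) ≈⟨ *-assoc x y z ⟨
    (x * y) * z ≈⟨ *-congʳ xy≈0 ⟩
    0# * z      ≈⟨ zeroˡ z ⟩
    0#          ∎

  -- An invertible zero makes the ring trivial; impossible cases are closed this way while the ring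
  -- is still arbitrary.
  unit-0⇒≈0 : Unit 0# → ∀ x → x ≈ 0#
  unit-0⇒≈0 u x = unit-cancelʳ u (zeroʳ x)

  -- Equality with zero cannot be decided for arbitrary reals. The subring confines every case
  -- distinction to elements for which it can be made.
  record DiscreteSubring p : Set (c ⊔ ℓ ⊔ Level.suc p) where
    field
      Member     : Carrier → Set p
      0-member   : Member 0#
      1-member   : Member 1#
      +-member   : ∀ {x y} → Member x → Member y → Member (x + y)
      *-member   : ∀ {x y} → Member x → Member y → Member (x * y)
      neg-member : ∀ {x} → Member x → Member (- x)
      0-or-unit  : ∀ {x} → Member x → x ≈ 0# ⊎ Unit x

    sum-member : ∀ {n} {t : Vector Carrier n} → (∀ i → Member (t i)) → Member (sum t)
    sum-member {zero}  m = 0-member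
    sum-member {suc n} m = +-member (m zero) (sum-member (m ∘ suc))

    sign-member : ∀ k → Member (sign k)
    sign-member zero    = 1-member
    sign-member (suc k) = *-member (neg-member 1-member) (sign-member k)

    det-member : ∀ {n} {A : Matrix n} → (∀ i j → Member (A i j)) → Member (det A)
    det-member {zero}  m = 1-member
    det-member {suc n} m = sum-member λ j → *-member (sign-member (toℕ j))
      (*-member (m zero j) (det-member (λ k l → m (suc k) (punchIn j l))))

    all-0-or-unit : ∀ {n} {x : Vector Carrier n} → (∀ i → Member (x i)) →
      (∀ i → x i ≈ 0#) ⊎ (∃[ i ] Unit (x i))
    all-0-or-unit {zero}  m = inj₁ λ ()
    all-0-or-unit {suc n} m with 0-or-unit (m zero) | all-0-or-unit (m ∘ suc)
    ... | inj₂ u    | _             = inj₂ (zero , u)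
    ... | inj₁ x₀≈0 | inj₂ (i , u)  = inj₂ (suc i , u)
    ... | inj₁ x₀≈0 | inj₁ xs≈0     = inj₁ λ { zero → x₀≈0 ; (suc i) → xs≈0 i }

    -- If a selection f of rows makes the columns other than the first
    -- nonsingular, the first-row cofactors of (r ∷ f) do not depend on r and
    -- annihilate row r as soon as det (r ∷ f) vanishes.
    select-rows-or-null : ∀ {m n} (B : Fin m → Vector Carrier n) → (∀ i j → Member (B i j)) →
      (∃[ f ] Unit (det (λ k → B (f k)))) ⊎
      (∃[ y ] (∃[ i ] Unit (y i)) × (∀ r → sum (λ j → B r j * y j) ≈ 0#))
    select-rows-or-null {n = zero}  B mB = inj₁ ((λ ()) , 1# , *-identityˡ 1#)
    select-rows-or-null {n = suc n} B mB
      with select-rows-or-null (λ r → B r ∘ suc) (λ r → mB r ∘ suc)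
    ... | inj₂ (y , (i , yᵢ) , By≈0) = inj₂ (0# Vector.∷ y , (suc i , yᵢ) , λ r →
      trans (+-cong (zeroʳ (B r zero)) (By≈0 r)) (+-identityˡ 0#))
    ... | inj₁ (f , u) with all-0-or-unit (λ r → det-member λ k → mB ((r Vector.∷ f) k))
    ...   | inj₂ (r , v) = inj₁ (r Vector.∷ f , v)
    -- The first entry of `y` is `sign 0` times the determinant that `f` makes invertible, so `y`
    -- has a unit entry.
    ...   | inj₁ dets≈0 = inj₂ (y , (zero , unit-* (unit-sign 0) u) , λ r →
      trans (sum-cong-≋ (λ j → swap (B r j) (sign (toℕ j)) (D j))) (dets≈0 r))
      where
      D y : Vector Carrier (suc n)
      D j = det (λ k l → B (f k) (punchIn j l))
      y j = sign (toℕ j) * D j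
      swap : ∀ b s d → b * (s * d) ≈ s * (b * d)
      swap = solve 3 (λ b s d → b :* (s :* d) := s :* (b :* d)) refl

    -- For a square matrix the selected rows have determinant `ε * det A`, and a factor of a unit is
    -- a unit.
    unit-det-or-null : ∀ {n} (A : Matrix n) → (∀ i j → Member (A i j)) →
      Unit (det A) ⊎ (∃[ y ] (∃[ i ] Unit (y i)) × Nullspace A y)
    unit-det-or-null A mA with select-rows-or-null A mA
    ... | inj₂ null    = inj₂ null
    ... | inj₁ (f , u) = let ε , eq = det-select-rows f in
      inj₁ (unit-*ʳ {ε} (unit-cong (eq A) u))

  -- Inverses and null vectors of symmetric matrices.

  1ᴹ-diagonal : ∀ {n} (i : Fin n) → 1ᴹ i i ≈ 1#
  1ᴹ-diagonal i = reflexive (≡.cong (λ b → if b then 1# else 0#) (dec-true (i ≟ i) ≡.refl))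

  1ᴹ-off-diagonal : ∀ {n} {i j : Fin n} → i ≢ j → 1ᴹ i j ≈ 0#
  1ᴹ-off-diagonal {i = i} {j} i≢j =
    reflexive (≡.cong (λ b → if b then 1# else 0#) (dec-false (i ≟ j) i≢j))

  1ᴹ-symmetric : ∀ {n} (i j : Fin n) → 1ᴹ i j ≈ 1ᴹ j i
  1ᴹ-symmetric i j with i ≟ j
  ... | yes ≡.refl = sym (1ᴹ-diagonal i)
  ... | no i≢j     = sym (1ᴹ-off-diagonal (i≢j ∘ ≡.sym))

  nonsingular⇒null≈0 : ∀ {n} {A : Matrix n} → Nonsingular A →
    ∀ y → Nullspace A y → ∀ i → y i ≈ 0#
  nonsingular⇒null≈0 {A = A} (B , _ , BA≈1) y Ay≈0 i = begin
    y i
      ≈⟨ *-identityˡ (y i) ⟨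
    1# * y i
      ≈⟨ *-congʳ (1ᴹ-diagonal i) ⟨
    1ᴹ i i * y i
      ≈⟨ sum-single (λ j → 1ᴹ i j * y j) i (λ {j} j≢i →
           trans (*-congʳ {y j} (1ᴹ-off-diagonal (j≢i ∘ ≡.sym))) (zeroˡ _)) ⟨
    sum (λ j → 1ᴹ i j * y j)
      ≈⟨ sum-cong-≋ (λ j → *-congʳ {y j} (BA≈1 i j)) ⟨
    sum (λ j → (B *ᴹ A) i j * y j)
      ≈⟨ bilinear-assoc (B i) A y ⟨
    sum (λ k → B i k * (A *ᵛ y) k)
      ≈⟨ sum-zero (λ k → trans (*-congˡ {B i k} (Ay≈0 k)) (zeroʳ _)) ⟩
    0# ∎

  Symmetricᴹ : ∀ {n} → Matrix n → Set ℓ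
  Symmetricᴹ A = A ≈ᴹ (A ᵀ)

  minor-symmetric : ∀ {n} {A : Matrix (suc n)} → Symmetricᴹ A → ∀ v → Symmetricᴹ (minor A v v)
  minor-symmetric A-sym v i j = A-sym (punchIn v i) (punchIn v j)

  adjugate-symmetric : ∀ {n} {A : Matrix n} → Symmetricᴹ A → Symmetricᴹ (adjugate A)
  adjugate-symmetric {suc n} {A} A-sym i j = *-cong
    (reflexive (≡.cong sign (ℕ.+-comm (toℕ i) (toℕ j))))
    (trans (det-cong λ k l → A-sym (punchIn j k) (punchIn i l))
      (det-transpose (minor A i j)))

  -- The row cofactors give a right inverse. As `A` and its adjugate are symmetric, transposing the
  -- product shows that it is a left inverse too.
  unit-det⇒nonsingular : ∀ {n} {A : Matrix n} → Symmetricᴹ A → Unit (det A) → Nonsingular A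
  unit-det⇒nonsingular {A = A} A-sym (d , det*d≈1) = B , AB≈1 , λ i j → begin
    sum (λ k → B i k * A k j)
      ≈⟨ sum-cong-≋ (λ k → trans (*-comm (B i k) (A k j))
           (*-cong (A-sym k j) (*-congʳ {d} (adjugate-symmetric A-sym i k)))) ⟩
    (A *ᴹ B) j i  ≈⟨ AB≈1 j i ⟩
    1ᴹ j i        ≈⟨ 1ᴹ-symmetric j i ⟩
    1ᴹ i j        ∎
    where
    B : Matrix _
    B i j = adjugate A i j * d
    AB≈ : ∀ i j → (A *ᴹ B) i j ≈ (A *ᴹ adjugate A) i j * d
    AB≈ i j = trans (sum-cong-≋ (λ k → sym (*-assoc (A i k) (adjugate A k j) d)))
      (sym (*-distribʳ-sum d (λ k → A i k * adjugate A k j)))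
    AB≈1 : (A *ᴹ B) ≈ᴹ 1ᴹ
    AB≈1 i j with i ≟ j
    ... | yes ≡.refl = trans (AB≈ i i) (trans (*-congʳ (cofactors-own-row A i)) det*d≈1)
    ... | no i≢j     = trans (AB≈ i j) (trans (*-congʳ (cofactors-alien-row A i≢j)) (zeroˡ d))

  singular-adjugate-column : ∀ {n} (A : Matrix n) → det A ≈ 0# →
    ∀ v → Nullspace A (λ u → adjugate A u v)
  singular-adjugate-column A det≈0 v i with i ≟ v
  ... | yes ≡.refl = trans (cofactors-own-row A i) det≈0
  ... | no i≢v     = cofactors-alien-row A i≢v

  -- With ŷ the extension of y by 0, A ŷ can be nonzero at v only, where
  -- xᵗ A ŷ = 0 and the invertible x v force it to vanish as well.
  extend-null : ∀ {n} {A : Matrix (suc n)} → Symmetricᴹ A →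
    ∀ x → Nullspace A x → ∀ {v} → Unit (x v) →
    ∀ y → Nullspace (minor A v v) y → Nullspace A (insertAt y v 0#)
  extend-null {n} {A} A-sym x Ax≈0 {v} xᵥ y My≈0 = Aŷ≈0
    where
    ŷ : Vector Carrier (suc n)
    ŷ = insertAt y v 0#

    Aŷ≈ : ∀ i → (A *ᵛ ŷ) i ≈ sum (λ k → A i (punchIn v k) * y k)
    Aŷ≈ i = begin
      (A *ᵛ ŷ) i
        ≈⟨ sum-remove {i = v} (λ j → A i j * ŷ j) ⟩
      A i v * ŷ v + sum (λ k → A i (punchIn v k) * ŷ (punchIn v k))
        ≈⟨ +-cong (trans (*-congˡ (reflexive (insertAt-lookup y v 0#))) (zeroʳ (A i v)))
             (sum-cong-≋ (λ k → *-congˡ {A i (punchIn v k)} (reflexive (insertAt-punchIn y v 0# k)))) ⟩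
      0# + sum (λ k → A i (punchIn v k) * y k)
        ≈⟨ +-identityˡ _ ⟩
      sum (λ k → A i (punchIn v k) * y k) ∎

    Aŷ≈0-off : ∀ {i} → i ≢ v → (A *ᵛ ŷ) i ≈ 0#
    Aŷ≈0-off {i} i≢v = ≡.subst (λ i → (A *ᵛ ŷ) i ≈ 0#) (punchIn-punchOut (i≢v ∘ ≡.sym))
      (trans (Aŷ≈ (punchIn v (punchOut (i≢v ∘ ≡.sym)))) (My≈0 (punchOut (i≢v ∘ ≡.sym))))

    Aŷ≈0-at : (A *ᵛ ŷ) v ≈ 0#
    Aŷ≈0-at = unit-cancelʳ xᵥ (begin
      (A *ᵛ ŷ) v * x v
        ≈⟨ *-comm _ _ ⟩
      x v * (A *ᵛ ŷ) v
        ≈⟨ sum-single (λ i → x i * (A *ᵛ ŷ) i) v (λ {i} i≢v →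
             trans (*-congˡ {x i} (Aŷ≈0-off i≢v)) (zeroʳ _)) ⟨
      sum (λ i → x i * (A *ᵛ ŷ) i)
        ≈⟨ bilinear-assoc x A ŷ ⟩
      sum (λ j → sum (λ i → x i * A i j) * ŷ j)
        ≈⟨ sum-zero (λ j → trans (*-congʳ {ŷ j} (trans
             (sum-cong-≋ (λ i → trans (*-comm (x i) (A i j)) (*-congʳ {x i} (A-sym i j))))
             (Ax≈0 j))) (zeroˡ _)) ⟩
      0# ∎)

    Aŷ≈0 : Nullspace A ŷ
    Aŷ≈0 i with i ≟ v
    ... | yes ≡.refl = Aŷ≈0-at
    ... | no i≢v     = Aŷ≈0-off i≢v

  nonsingular⇒unit-det : ∀ {p} (D : DiscreteSubring p) {n} {A : Matrix n} →
    (∀ i j → DiscreteSubring.Member D (A i j)) → Nonsingular A → Unit (det A)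
  nonsingular⇒unit-det D {A = A} A-mem ns with DiscreteSubring.unit-det-or-null D A A-mem
  ... | inj₁ u = u
  ... | inj₂ (y , (i , yᵢ) , Ay≈0) =
    -- A null vector with a unit entry would make zero a unit. In the resulting trivial ring zero
    -- itself serves as the inverse.
    0# , trans (zeroʳ _) (sym (unit-0⇒≈0 (unit-cong (nonsingular⇒null≈0 ns y Ay≈0 i) yᵢ) 1#))

  -- Symmetric matrices of nullity one.

  module NullityOne {p} (D : DiscreteSubring p) {n} (A : Matrix (suc n))
    (A-sym : Symmetricᴹ A) (A-mem : ∀ i j → DiscreteSubring.Member D (A i j))
    (nullity-1 : HasDimension (Nullspace A) 1) where

    open DiscreteSubring D
    open IsBasis (proj₂ nullity-1)

    β : Vector Carrier (suc n)
    β = proj₁ nullity-1 zero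

    multiple : ∀ x → Nullspace A x → ∃[ k ] (∀ i → x i ≈ k * β i)
    multiple x Ax≈0 = let a , x≈ = spanning x Ax≈0 in
      a zero , λ i → trans (x≈ i) (+-identityʳ _)

    -- By symmetry `β` is also a left null vector, so `det A` annihilates all its entries.
    -- Independence, applied with coefficient `det A`, then concludes without locating an invertible
    -- entry of `β`.
    det≈0 : det A ≈ 0#
    det≈0 = independent (λ _ → det A) (λ i → begin
      det A * β i + 0# ≈⟨ +-identityʳ _ ⟩
      det A * β i      ≈⟨ *-comm _ _ ⟩
      β i * det A      ≈⟨ left-null-det A β (λ k → trans
        (sum-cong-≋ (λ j → trans (*-comm (β j) (A j k)) (*-congʳ {β j} (A-sym j k))))
        (members zero k)) i ⟩
      0#               ∎) zero

    adjugate-column : ∀ v → Nullspace A (λ u → adjugate A u v)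
    adjugate-column = singular-adjugate-column A det≈0

    adjugate-diagonal : ∀ v → adjugate A v v ≈ det (minor A v v)
    adjugate-diagonal v = trans (*-congʳ (sign-double (toℕ v))) (*-identityˡ _)

    minor-member : ∀ v i j → Member (minor A v v i j)
    minor-member v i j = A-mem (punchIn v i) (punchIn v j)

    support⇒unit-minor : ∀ x → Nullspace A x → ∀ {v} → Unit (x v) → Unit (det (minor A v v))
    support⇒unit-minor x Ax≈0 {v} xᵥ with unit-det-or-null (minor A v v) (minor-member v)
    ... | inj₁ u = u
    ... | inj₂ (y , (i , yᵢ) , My≈0) =
      0# , trans (zeroʳ _) (sym (unit-0⇒≈0 (unit-cong yᵢ≈0 yᵢ) 1#))
      where
      ŷ : Vector Carrier (suc n)
      ŷ = insertAt y v 0#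
      k = multiple x Ax≈0
      a = multiple ŷ (extend-null A-sym x Ax≈0 xᵥ y My≈0)
      a≈0 : proj₁ a ≈ 0#
      -- The entry of `ŷ` at `v` is zero, while `β v` is a unit because the unit `x v` is a multiple
      -- of it.
      a≈0 = unit-cancelʳ (unit-*ʳ (unit-cong (proj₂ k v) xᵥ))
        (trans (sym (proj₂ a v)) (reflexive (insertAt-lookup y v 0#)))
      yᵢ≈0 : y i ≈ 0#
      yᵢ≈0 = begin
        y i                          ≈⟨ reflexive (insertAt-punchIn y v 0# i) ⟨
        ŷ (punchIn v i)              ≈⟨ proj₂ a (punchIn v i) ⟩
        proj₁ a * β (punchIn v i)    ≈⟨ *-congʳ a≈0 ⟩
        0# * β (punchIn v i)         ≈⟨ zeroˡ _ ⟩
        0#                           ∎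

    -- Column `v` of the adjugate is `k * β`. Its diagonal entry is an invertible principal minor,
    -- so `k` is a unit; `β u` is one because `x u` is a multiple of it.
    support⇒unit-adjugate : ∀ x y → Nullspace A x → Nullspace A y →
      ∀ {u v} → Unit (x u) → Unit (y v) → Unit (adjugate A u v)
    support⇒unit-adjugate x y Ax≈0 Ay≈0 {u} {v} xᵤ yᵥ =
      let k , adj≈ = multiple (λ w → adjugate A w v) (adjugate-column v)
          l , x≈   = multiple x Ax≈0
      in unit-cong (sym (adj≈ u)) (unit-*
           (unit-*ˡ (unit-cong (trans (sym (adjugate-diagonal v)) (adj≈ v))
             (support⇒unit-minor y Ay≈0 yᵥ)))
           (unit-*ʳ {l} (unit-cong (x≈ u) xᵤ)))

    -- With columns `u` and `v` written as multiples of `β`, this is the vanishing of the two-by-two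
    -- minor on rows and columns `u` and `v`, read with the symmetry of the adjugate.
    adjugate-rank-one : ∀ u v →
      adjugate A v u * adjugate A v u ≈ det (minor A v v) * det (minor A u u)
    adjugate-rank-one u v = let k , u≈ = multiple (λ w → adjugate A w u) (adjugate-column u)
                                l , v≈ = multiple (λ w → adjugate A w v) (adjugate-column v) in begin
      adjugate A v u * adjugate A v u
        ≈⟨ *-cong (u≈ v) (trans (adjugate-symmetric A-sym v u) (v≈ u)) ⟩
      (k * β v) * (l * β u)
        ≈⟨ solve 4 (λ k l a b → (k :* a) :* (l :* b) := (l :* a) :* (k :* b)) refl k l (β v) (β u) ⟩
      (l * β v) * (k * β u)
        ≈⟨ *-cong (trans (sym (v≈ v)) (adjugate-diagonal v)) (trans (sym (u≈ u)) (adjugate-diagonal u)) ⟩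
      det (minor A v v) * det (minor A u u) ∎

    -- Both `x` and column `u` of the adjugate are multiples of `β`, hence proportional; comparing
    -- entries at `u` dictates the factor `c`.
    null-rescale : ∀ x → Nullspace A x → ∀ {u} → Unit (x u) →
      ∃[ c ] Unit c × (∀ v → c * x v ≈ adjugate A v u)
    null-rescale x Ax≈0 {u} xᵤ@(z , xᵤz≈1) =
      let l , x≈   = multiple x Ax≈0
          k , adj≈ = multiple (λ w → adjugate A w u) (adjugate-column u)
          c = adjugate A u u * z
      in c
       , unit-* (support⇒unit-adjugate x x Ax≈0 Ax≈0 xᵤ xᵤ)
                (x u , trans (*-comm z (x u)) xᵤz≈1)
       , λ v → begin
           c * x v
             ≈⟨ *-cong (*-congʳ (adj≈ u)) (x≈ v) ⟩
           ((k * β u) * z) * (l * β v)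
             ≈⟨ solve 5 (λ k a z l b →
                  ((k :* a) :* z) :* (l :* b) := ((l :* a) :* z) :* (k :* b))
                  refl k (β u) z l (β v) ⟩
           ((l * β u) * z) * (k * β v)
             ≈⟨ *-cong (trans (*-congʳ (sym (x≈ u))) xᵤz≈1) (sym (adj≈ v)) ⟩
           1# * adjugate A v u
             ≈⟨ *-identityˡ _ ⟩
           adjugate A v u ∎

    Supported : Fin (suc n) → Set (c ⊔ ℓ)
    Supported v = ∃[ x ] Nullspace A x × Unit (x v)

    unit-adjugate⇔supported : ∀ u v → Unit (adjugate A u v) ⇔ (Supported u × Supported v)
    unit-adjugate⇔supported u v = mk⇔
      -- Column `v` of the adjugate witnesses that `u` is supported; by symmetry column `u` does so
      -- for `v`.
      (λ unit → ((λ w → adjugate A w v) , adjugate-column v , unit)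
              , ((λ w → adjugate A w u) , adjugate-column u
                , unit-cong (adjugate-symmetric A-sym u v) unit))
      (λ ((x , Ax≈0 , xᵤ) , (y , Ay≈0 , yᵥ)) → support⇒unit-adjugate x y Ax≈0 Ay≈0 xᵤ yᵥ)

    -- With minor A v v in place of B, instantiating R by ℝ would make the type
    -- checker compare normal forms of real arithmetic.
    supported⇔nonsingular-minor : ∀ v B → minor A v v ≡ B → Supported v ⇔ Nonsingular B
    supported⇔nonsingular-minor v _ ≡.refl = mk⇔
      (λ (x , Ax≈0 , xᵥ) →
        unit-det⇒nonsingular (minor-symmetric A-sym v) (support⇒unit-minor x Ax≈0 xᵥ))
      (λ ns → (λ w → adjugate A w v) , adjugate-column v
            , unit-cong (sym (adjugate-diagonal v)) (nonsingular⇒unit-det D (minor-member v) ns))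

    -- `Singular` is a mere negation; the dichotomy for the determinant of the minor turns it into
    -- an equation.
    singular-minor⇔adjugate≈0 : ¬ 1# ≈ 0# → ∀ v B → minor A v v ≡ B →
      Singular B ⇔ adjugate A v v ≈ 0#
    singular-minor⇔adjugate≈0 1≉0 v _ ≡.refl = mk⇔ to from
      where
      to : Singular (minor A v v) → adjugate A v v ≈ 0#
      to singular with 0-or-unit (det-member (minor-member v))
      ... | inj₁ d≈0 = trans (adjugate-diagonal v) d≈0
      ... | inj₂ u   = contradiction (unit-det⇒nonsingular (minor-symmetric A-sym v) u) singular
      from : adjugate A v v ≈ 0# → Singular (minor A v v)
      from adj≈0 ns = 1≉0 (unit-0⇒≈0
        (unit-cong (trans (sym (adjugate-diagonal v)) adj≈0)
          (nonsingular⇒unit-det D (minor-member v) ns)) 1#)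

    -- A null vector is fixed only up to a scalar, so the squares are taken of the multiple of `x`
    -- that equals column `u` of the adjugate.
    null-square : ∀ x → Nullspace A x → ∀ {u} → Unit (x u) →
      ∃[ c ] Unit c × (∀ v → (c * x v) * (c * x v) ≈ det (minor A v v) * det (minor A u u))
    null-square x Ax≈0 {u} xᵤ = let c , unit , cx≈ = null-rescale x Ax≈0 xᵤ in
      c , unit , λ v → trans (*-cong (cx≈ v) (cx≈ v)) (adjugate-rank-one u v)

-- Apartness and invertibility of real numbers.

open import Data.Nat.Base using (_+_; _<_)
open import Data.Vec.Functional using (replicate; _++_)
open import Defs
open import Relation.Binary.PropositionalEquality using (refl; sym; trans; cong; subst)
open Determinants ℝ-commutativeRing

-- Termwise reciprocals exist only from index `N` on, so they are taken of the shifted sequence `X`.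
-- Then the product minus one is the bounded `y` times the null difference between `x` and its
-- shift.
#0⇒unit : ∀ x → x # 0ℝ → Unit x
#0⇒unit x (ε , ε>0 , N , ε≤) = mkℝ y y-cauchy , null-cong y*diff≡x*y-1
  (null₂⇒null (null₂-* (λ m _ → m) (λ r _ → r) y-bounded tail-diff))
  where
  X : ℕ → ℚ
  X n = seq x (n ℕ.+ N)

  ε≤∣X∣ : ∀ n → ε ℚ.≤ ∣ X n ∣
  ε≤∣X∣ n = subst (λ r → ε ℚ.≤ ∣ r ∣) (ℚ.+-identityʳ (X n)) (ε≤ (n ℕ.+ N) (ℕ.m≤n+m N n))

  X≢0 : ∀ n → X n ≢ 0ℚ
  X≢0 n X≡0 = ℚ.<-irrefl refl (ℚ.<-≤-trans ε>0 (subst (λ r → ε ℚ.≤ ∣ r ∣) X≡0 (ε≤∣X∣ n)))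

  y : ℕ → ℚ
  y n = (ℚ.1/ X n) {{ℚ.≢-nonZero (X≢0 n)}}

  X*y≡1 : ∀ n → X n ℚ.* y n ≡ 1ℚ
  X*y≡1 n = ℚ.*-inverseʳ (X n) {{ℚ.≢-nonZero (X≢0 n)}}

  y-bounded : Bounded y
  y-bounded = 1/ε , ℚ.1/pos⇒pos ε {{ℚ.positive ε>0}} , 0 , λ n _ →
    ℚ.*-cancelˡ-≤-pos ε {{ℚ.positive ε>0}} (begin
      ε ℚ.* ∣ y n ∣        ≤⟨ ℚ.*-monoʳ-≤-nonNeg ∣ y n ∣ {{ℚ.∣-∣-nonNeg (y n)}} (ε≤∣X∣ n) ⟩
      ∣ X n ∣ ℚ.* ∣ y n ∣  ≡⟨ ℚ.∣p*q∣≡∣p∣*∣q∣ (X n) (y n) ⟨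
      ∣ X n ℚ.* y n ∣      ≡⟨ cong ∣_∣ (X*y≡1 n) ⟩
      1ℚ                   ≡⟨ ℚ.*-inverseʳ ε {{ℚ.pos⇒nonZero ε {{ℚ.positive ε>0}}}} ⟨
      ε ℚ.* 1/ε            ∎)
    where
    open ℚ.≤-Reasoning
    1/ε : ℚ
    1/ε = (ℚ.1/ ε) {{ℚ.pos⇒nonZero ε {{ℚ.positive ε>0}}}}

  X-cauchy : Null₂ (λ m n → X n ℚ.- X m)
  X-cauchy δ δ>0 with cauchy x δ δ>0
  ... | M , q = M , λ m n M≤m M≤n →
    q (n ℕ.+ N) (m ℕ.+ N) (ℕ.m≤n⇒m≤n+o N M≤n) (ℕ.m≤n⇒m≤n+o N M≤m)

  tail-diff : Null₂ (λ n _ → seq x n ℚ.- X n)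
  tail-diff δ δ>0 with cauchy x δ δ>0
  ... | M , q = M , λ n _ M≤n _ → q n (n ℕ.+ N) M≤n (ℕ.m≤n⇒m≤n+o N M≤n)

  y-cauchy : Null₂ (λ m n → y m ℚ.- y n)
  -- A difference of reciprocals is the difference of the terms, reversed, times both reciprocals,
  -- which are bounded.
  y-cauchy = null₂-cong eq
    (null₂-* (λ m _ → m) (λ r _ → r) y-bounded
      (null₂-* (λ _ n → n) (λ _ r → r) y-bounded X-cauchy))
    where
    open +-*-Solver
    eq : ∀ m n → y m ℚ.* (y n ℚ.* (X n ℚ.- X m)) ≡ y m ℚ.- y n
    eq m n = trans
      (solve 4 (λ p q a b → p :* (q :* (a :- b)) := p :* (a :* q) :- q :* (b :* p)) refl
        (y m) (y n) (X n) (X m))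
      (≡.cong₂ ℚ._-_
        (trans (cong (y m ℚ.*_) (X*y≡1 n)) (ℚ.*-identityʳ (y m)))
        (trans (cong (y n ℚ.*_) (X*y≡1 m)) (ℚ.*-identityʳ (y n))))

  y*diff≡x*y-1 : ∀ n → y n ℚ.* (seq x n ℚ.- X n) ≡ seq x n ℚ.* y n ℚ.- 1ℚ
  y*diff≡x*y-1 n = trans
    (solve 3 (λ p a b → p :* (a :- b) := a :* p :- b :* p) refl (y n) (seq x n) (X n))
    (cong (λ r → seq x n ℚ.* y n ℚ.- r) (X*y≡1 n))
    where open +-*-Solver

reverse-triangle : ∀ {ε} p q → ∣ p ℚ.- q ∣ ℚ.< ε → ∣ q ∣ ℚ.- ε ℚ.≤ ∣ p ∣
reverse-triangle {ε} p q p-q<ε = begin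
  ∣ q ∣ ℚ.- ε
    ≡⟨ cong (λ r → ∣ r ∣ ℚ.- ε) (solve 2 (λ p q → p :- (p :- q) := q) refl p q) ⟨
  ∣ p ℚ.- (p ℚ.- q) ∣ ℚ.- ε
    ≤⟨ ℚ.+-monoˡ-≤ (ℚ.- ε) (ℚ.∣p-q∣≤∣p∣+∣q∣ p (p ℚ.- q)) ⟩
  (∣ p ∣ ℚ.+ ∣ p ℚ.- q ∣) ℚ.- ε
    ≤⟨ ℚ.+-monoˡ-≤ (ℚ.- ε) (ℚ.+-monoʳ-≤ ∣ p ∣ (ℚ.<⇒≤ p-q<ε)) ⟩
  (∣ p ∣ ℚ.+ ε) ℚ.- ε
    ≡⟨ solve 2 (λ p ε → (p :+ ε) :- ε := p) refl ∣ p ∣ ε ⟩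
  ∣ p ∣ ∎
  where
  open ℚ.≤-Reasoning
  open +-*-Solver using (solve; _:+_; _:-_; _:=_)

-- If `B` eventually bounds the absolute value of `y`, a product of size at least `ε` forces `x` to
-- have size at least `ε / B`, which is `δ`.
*#0⇒#0 : ∀ x y → (x *ℝ y) # 0ℝ → x # 0ℝ
*#0⇒#0 x y (ε , ε>0 , N , ε≤) =
  let B , B>0 , M , ∣y∣≤B = bounded y
      δ , δ>0 , Bδ≡ε      = scale {ε} {B} {{B>0}} ε>0
  in δ , δ>0 , M ℕ.⊔ N , λ n M⊔N≤n →
    ℚ.*-cancelˡ-≤-pos B {{B>0}} (subst (ℚ._≤ B ℚ.* ∣ seq x n ℚ.- 0ℚ ∣) (sym Bδ≡ε)
      (B-bound n (∣y∣≤B n (ℕ.m⊔n≤o⇒m≤o M N M⊔N≤n)) (ε≤ n (ℕ.m⊔n≤o⇒n≤o M N M⊔N≤n))))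
  where
  open ℚ.≤-Reasoning
  B-bound : ∀ {B} n → ∣ seq y n ∣ ℚ.≤ B → ε ℚ.≤ ∣ seq x n ℚ.* seq y n ℚ.- 0ℚ ∣ →
            ε ℚ.≤ B ℚ.* ∣ seq x n ℚ.- 0ℚ ∣
  B-bound {B} n ∣b∣≤B ε≤∣ab∣ = let a = seq x n ; b = seq y n in begin
    ε                       ≤⟨ ε≤∣ab∣ ⟩
    ∣ a ℚ.* b ℚ.- 0ℚ ∣      ≡⟨ cong ∣_∣ (ℚ.+-identityʳ (a ℚ.* b)) ⟩
    ∣ a ℚ.* b ∣             ≡⟨ ℚ.∣p*q∣≡∣p∣*∣q∣ a b ⟩
    ∣ a ∣ ℚ.* ∣ b ∣         ≤⟨ ℚ.*-monoˡ-≤-nonNeg ∣ a ∣ {{ℚ.∣-∣-nonNeg a}} ∣b∣≤B ⟩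
    ∣ a ∣ ℚ.* B             ≡⟨ ℚ.*-comm ∣ a ∣ B ⟩
    B ℚ.* ∣ a ∣             ≡⟨ cong (λ r → B ℚ.* ∣ r ∣) (ℚ.+-identityʳ a) ⟨
    B ℚ.* ∣ a ℚ.- 0ℚ ∣      ∎

≈1⇒#0 : ∀ x → x ≈ 1ℝ → x # 0ℝ
≈1⇒#0 x x≈1 =
  let N , close = x≈1 ½ (ℚ.positive⁻¹ ½)
  in ½ , ℚ.positive⁻¹ ½ , N , λ n N≤n →
    subst (λ r → ½ ℚ.≤ ∣ r ∣) (sym (ℚ.+-identityʳ (seq x n)))
      (reverse-triangle (seq x n) 1ℚ (close n N≤n))

unit⇒#0 : ∀ x → Unit x → x # 0ℝ
unit⇒#0 x (y , xy≈1) = *#0⇒#0 x y (≈1⇒#0 (x *ℝ y) xy≈1)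

1≉0 : ¬ 1ℝ ≈ 0ℝ
1≉0 1≈0 with 1≈0 1ℚ (ℚ.positive⁻¹ 1ℚ)
... | N , 1<1 = ℚ.<-irrefl {1ℚ} refl (1<1 N ℕ.≤-refl)

-- Membership asks for a constant representing sequence, so that the decidable equality of `ℚ`
-- settles whether the real is zero; termwise operations preserve constancy.
rationals : DiscreteSubring 0ℓ
rationals = record
  { Member     = λ x → ∃[ q ] (∀ n → seq x n ≡ q)
  ; 0-member   = 0ℚ , λ _ → refl
  ; 1-member   = 1ℚ , λ _ → refl
  ; +-member   = λ (p , x≡) (q , y≡) → p ℚ.+ q , λ n → ≡.cong₂ ℚ._+_ (x≡ n) (y≡ n)
  ; *-member   = λ (p , x≡) (q , y≡) → p ℚ.* q , λ n → ≡.cong₂ ℚ._*_ (x≡ n) (y≡ n)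
  ; neg-member = λ (q , x≡) → ℚ.- q , λ n → cong ℚ.-_ (x≡ n)
  ; 0-or-unit  = λ {x} → 0-or-unit x
  }
  where
  0-or-unit : ∀ x → ∃[ q ] (∀ n → seq x n ≡ q) → x ≈ 0ℝ ⊎ Unit x
  0-or-unit x (q , x≡) with q ℚ.≟ 0ℚ
  ... | yes refl = inj₁ (≡⇒≈ x 0ℝ x≡)
  ... | no q≢0   = inj₂ (fromℚ 1/q , ≡⇒≈ (x *ℝ fromℚ 1/q) 1ℝ λ n →
    trans (cong (ℚ._* 1/q) (x≡ n)) (ℚ.*-inverseʳ q {{ℚ.≢-nonZero q≢0}}))
    where
    1/q : ℚ
    1/q = (ℚ.1/ q) {{ℚ.≢-nonZero q≢0}}

-- Graphs of nullity one.

adjacency-symmetric : ∀ {n} (G : Graph n) → Symmetricᴹ (adjacency G)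
adjacency-symmetric G i j with Graph._∼?_ G i j | Graph._∼?_ G j i
... | yes _   | yes _   = ≡⇒≈ 1ℝ 1ℝ (λ _ → refl)
... | no _    | no _    = ≡⇒≈ 0ℝ 0ℝ (λ _ → refl)
... | yes i∼j | no j≁i  = contradiction (Graph.∼-sym G i∼j) j≁i
... | no i≁j  | yes j∼i = contradiction (Graph.∼-sym G j∼i) i≁j

adjacency-rational : ∀ {n} (G : Graph n) i j → DiscreteSubring.Member rationals (adjacency G i j)
adjacency-rational G i j with Graph._∼?_ G i j
... | yes _ = DiscreteSubring.1-member rationals
... | no _  = DiscreteSubring.0-member rationals

#0⇔unit : ∀ x → x # 0ℝ ⇔ Unit x
#0⇔unit x = mk⇔ (#0⇒unit x) (unit⇒#0 x)

module NullityOneGraph {n} (G : Graph (suc n)) (nullity-1 : HasNullity G 1) where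

  open NullityOne rationals (adjacency G) (adjacency-symmetric G) (adjacency-rational G) nullity-1

  ∈supp⇔supported : ∀ v → v ∈Supp G ⇔ Supported v
  ∈supp⇔supported v = mk⇔
    (λ (x , Ax≈0 , xᵥ#0) → x , Ax≈0 , #0⇒unit (x v) xᵥ#0)
    (λ (x , Ax≈0 , xᵥ)   → x , Ax≈0 , unit⇒#0 (x v) xᵥ)

  singular⇔adj≈0 : ∀ v → Singular (G ∖ v) ⇔ adjᴳ G v v ≈ 0ℝ
  singular⇔adj≈0 v = singular-minor⇔adjugate≈0 1≉0 v (adjacency (G ∖ v)) refl

  adj#0⇔∈supp : ∀ u v → adjᴳ G u v # 0ℝ ⇔ (u ∈Supp G × v ∈Supp G)
  adj#0⇔∈supp u v =
    ⇔-sym (∈supp⇔supported u ×-⇔ ∈supp⇔supported v)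
      ⇔-∘ (unit-adjugate⇔supported u v ⇔-∘ #0⇔unit (adjᴳ G u v))

  ∈supp⇔nonsingular : ∀ v → v ∈Supp G ⇔ Nonsingular (G ∖ v)
  ∈supp⇔nonsingular v = supported⇔nonsingular-minor v (adjacency (G ∖ v)) refl ⇔-∘ ∈supp⇔supported v

  null-square#0 : ∀ x → 𝒩 G x → ∀ u → x u # 0ℝ →
    ∃[ c ] c # 0ℝ × (∀ v → (c *ℝ x v) *ℝ (c *ℝ x v) ≈ detᴳ (G ∖ v) *ℝ detᴳ (G ∖ u))
  null-square#0 x Ax≈0 u xᵤ#0 =
    let c , c-unit , square = null-square x Ax≈0 {u} (#0⇒unit (x u) xᵤ#0)
    in c , unit⇒#0 c c-unit , square

-- The order is a variable here so that it can be split into zero and successor, which `s + t` does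
-- not allow directly. Without vertices all claims are vacuous.
nullity-one : ∀ n (G : Graph n) → HasNullity G 1 →
  (∀ v → Singular (G ∖ v) ⇔ adjᴳ G v v ≈ 0ℝ)
  × (∀ u v → adjᴳ G u v # 0ℝ ⇔ (u ∈Supp G × v ∈Supp G))
  × (∀ v → v ∈Supp G ⇔ Nonsingular (G ∖ v))
  × (∀ x → 𝒩 G x → ∀ u → x u # 0ℝ →
      ∃[ c ] c # 0ℝ × (∀ v → (c *ℝ x v) *ℝ (c *ℝ x v) ≈ detᴳ (G ∖ v) *ℝ detᴳ (G ∖ u)))
nullity-one zero    G nullity-1 = (λ ()) , (λ ()) , (λ ()) , λ x Ax≈0 ()
nullity-one (suc n) G nullity-1 =
  singular⇔adj≈0 , adj#0⇔∈supp , ∈supp⇔nonsingular , null-square#0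
  where open NullityOneGraph G nullity-1

theorem6p3 : (s t : ℕ) (G : Graph (s + t)) →
    HasNullity G 1 →
    ((v : Fin (s + t)) → v ∈Supp G ⇔ toℕ v < s) →
    ((v : Fin (s + t)) → Singular (G ∖ v) ⇔ adjᴳ G v v ≈ 0ℝ)
    × ((u v : Fin (s + t)) → adjᴳ G u v # 0ℝ ⇔ (u ∈Supp G × v ∈Supp G))
    × ((v : Fin (s + t)) → v ∈Supp G ⇔ Nonsingular (G ∖ v))
    × ((x : Vector ℝ s) →
    𝒩 G (x ++ replicate t 0ℝ) →
    (∃[ i ] x i # 0ℝ) →
    ∃[ c ] c # 0ℝ × ∃[ u ] u ∈Supp G × ((v : Fin (s + t)) → v ∈Supp G →
    (c *ℝ (x ++ replicate t 0ℝ) v) *ℝ (c *ℝ (x ++ replicate t 0ℝ) v)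
    ≈ detᴳ (G ∖ v) *ℝ detᴳ (G ∖ u)))
theorem6p3 s t G nullity-1 _ =
  let part₁ , part₂ , part₃ , square = nullity-one (s + t) G nullity-1
  in part₁ , part₂ , part₃ , λ x x∈𝒩 (i , xᵢ#0) →
    let x̂    = x ++ replicate t 0ℝ
        -- Any vertex where `x` is apart from zero can be the fixed `u`; `x̂` itself witnesses that
        -- it lies in the support.
        u    = i ↑ˡ t
        x̂ᵤ#0 = subst (_# 0ℝ) (sym (lookup-++ˡ x (replicate t 0ℝ) i)) xᵢ#0
        c , c#0 , cx̂² = square x̂ x∈𝒩 u x̂ᵤ#0
    in c , c#0 , u , (x̂ , x∈𝒩 , x̂ᵤ#0) , λ v _ → cx̂² v
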